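{- Let $\perp$ be a ternary relation between small subsets of the big model (written $A\perp_C B$) satisfying invariance and monotonicity, and let $\perp^*$ be the relation derived from it by $$A\perp^*_C B \iff \text{for all } \hat B\supseteq B \text{ there is } A'\equiv_{BC}A \text{ such that } A'\perp_C\hat B .$$ Then $\perp^*$ satisfies invariance, monotonicity and extension. If, moreover, $\perp$ satisfies one of the following axioms and properties, then $\perp^*$ also satisfies it: base monotonicity, transitivity, normality, anti-reflexivity, existence.
   Context: $T$ is a complete consistent first-order theory (possibly many-sorted); we work in a big saturated model of $T$. All sets $A,B,C,\dots$ are small subsets of the big model; $AB$ means $A\cup B$; $\operatorname{acl}$ is algebraic closure. $A\equiv_B A'$ means that some automorphism of the big model fixing $B$ pointwise maps the set $A$ onto the set $A'$; $(A,B,C)\equiv(A',B',C')$ means that some automorphism maps $A$ onto $A'$, $B$ onto $B'$ and $C$ onto $C'$. Properties of a ternary relation $\perp$ between small sets: - (invariance) If $A\perp_CB$ and $(A',B',C')\equiv(A,B,C)$, then $A'\perp_{C'}B'$. - (monotonicity) If $A\perp_CB$, $A'\subseteq A$ and $B'\subseteq B$, then $A'\perp_CB'$. - (base monotonicity) If $D\subseteq C\subseteq B$ and $A\perp_DB$, then $A\perp_CB$. - (transitivity) If $D\subseteq C\subseteq B$, $B\perp_CA$ and $C\perp_DA$, then $B\perp_DA$. - (normality) $A\perp_CB$ implies $AC\perp_CB$. - (extension) If $A\perp_CB$ and $\hat B\supseteq B$, then there is $A'\equiv_{BC}A$ such that $A'\perp_C\hat B$. - (anti-reflexivity) $a\perp_Ba$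 implies $a\in\operatorname{acl}B$ (for single elements $a$). - (existence) For any $A,B,C$ there is $A'\equiv_CA$ such that $A'\perp_CB$. -}

module Defs where

open import Level using (Level; _⊔_; suc; Lift)
open import Data.Empty using (⊥)
open import Data.Unit.Polymorphic using (⊤)
open import Data.List.Base using (List)
open import Data.List.Membership.Propositional using () renaming (_∈_ to _∈ₗ_)
open import Data.List.Relation.Unary.All using (All; []; _∷_)
import Data.List.Relation.Unary.All as All
open import Data.Maybe.Base using (Maybe; just; nothing; maybe′)
open import Data.Product using (Σ; ∃; ∃-syntax; _×_; _,_; proj₁; proj₂)
open import Data.Sum.Base using (_⊎_; [_,_]′)
open import Function.Base using (_∘_)
open import Function.Bundles using (_↔_; _⇔_; Inverse)
open import Relation.Binary.PropositionalEquality using (_≡_)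
open import Relation.Unary using (Pred; _∈_; _⊆_; _≐_)

-- Size convention.  The universe Set ℓ plays the role of the (inaccessible)
-- cardinal κ below which sets are called small: languages, index types of
-- small sets and sets of formulas live in Set ℓ, whereas the models live in
-- Set (suc ℓ) and are therefore allowed to be large.

record Signature ℓ : Set (suc ℓ) where
  field
    Sort : Set ℓ
    Fun  : Set ℓ
    dom  : Fun → List Sort
    cod  : Fun → Sort
    Rel  : Set ℓ
    ar   : Rel → List Sort

module _ {ℓ} (L : Signature ℓ) where
  open Signature L

  -- Contexts may be infinite (but are small), so that a type in infinitely
  -- many variables is a set of formulas over a single context.
  record Ctx : Set (suc ℓ) where
    constructor ctx
    field
      Var    : Set ℓ
      sortOf : Var → Sort

  open Ctx

  ∅ : Ctx
  ∅ = ctx (Lift ℓ ⊥) λ ()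

  infixl 5 _▸_
  _▸_ : Ctx → Sort → Ctx
  Γ ▸ s = ctx (Maybe (Var Γ)) (maybe′ (sortOf Γ) s)

  data Term (Γ : Ctx) : Sort → Set ℓ where
    var : (i : Var Γ) → Term Γ (sortOf Γ i)
    app : (f : Fun) → All (Term Γ) (dom f) → Term Γ (cod f)

  -- The logic is classical, so falsity, implication and the universal
  -- quantifier suffice.
  data Formula (Γ : Ctx) : Set ℓ where
    _≈′_ : ∀ {s} → Term Γ s → Term Γ s → Formula Γ
    rel′ : (r : Rel) → All (Term Γ) (ar r) → Formula Γ
    ⊥′   : Formula Γ
    _⇒′_ : Formula Γ → Formula Γ → Formula Γ
    ∀′   : (s : Sort) → Formula (Γ ▸ s) → Formula Γ

  Sentence : Set ℓ
  Sentence = Formula ∅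

  Theory : Set (suc ℓ)
  Theory = Pred Sentence ℓ

  -- As usual in many-sorted logic, no sort of a structure is empty.
  record Structure : Set (suc (suc ℓ)) where
    field
      Dom      : Sort → Set (suc ℓ)
      nonempty : ∀ s → Dom s
      funI     : (f : Fun) → All Dom (dom f) → Dom (cod f)
      relI     : (r : Rel) → All Dom (ar r) → Set (suc ℓ)

module _ {ℓ} {L : Signature ℓ} where
  open Signature L
  open Ctx
  open Structure

  ¬′_ : {Γ : Ctx L} → Formula L Γ → Formula L Γ
  ¬′ φ = φ ⇒′ ⊥′

  Env : Structure L → Ctx L → Set (suc ℓ)
  Env M Γ = (i : Var Γ) → Dom M (sortOf Γ i)

  module _ (M : Structure L) where

    extend : ∀ {Γ s} → Env M Γ → Dom M s → Env M (_▸_ L Γ s)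
    extend ρ x (just i) = ρ i
    extend ρ x nothing  = x

    eval  : ∀ {Γ s} → Env M Γ → Term L Γ s → Dom M s
    evals : ∀ {Γ ss} → Env M Γ → All (Term L Γ) ss → All (Dom M) ss
    eval ρ (var i)    = ρ i
    eval ρ (app f ts) = funI M f (evals ρ ts)
    evals ρ []       = []
    evals ρ (t ∷ ts) = eval ρ t ∷ evals ρ ts

    Sat : ∀ {Γ} → Env M Γ → Formula L Γ → Set (suc ℓ)
    Sat ρ (t ≈′ u)    = eval ρ t ≡ eval ρ u
    Sat ρ (rel′ r ts) = relI M r (evals ρ ts)
    Sat ρ ⊥′          = Lift (suc ℓ) ⊥
    Sat ρ (φ ⇒′ ψ)    = Sat ρ φ → Sat ρ ψ
    Sat ρ (∀′ s φ)    = (x : Dom M s) → Sat (extend ρ x) φ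

  _⊨_ : Structure L → Sentence L → Set (suc ℓ)
  M ⊨ φ = Sat M {∅ L} (λ ()) φ

  _IsModelOf_ : Structure L → Theory L → Set (suc ℓ)
  M IsModelOf T = ∀ φ → φ ∈ T → M ⊨ φ

  _Entails_ : Theory L → Sentence L → Set (suc (suc ℓ))
  T Entails φ = (N : Structure L) → N IsModelOf T → N ⊨ φ

  -- Consistency and completeness are those of semantic consequence.
  Consistent : Theory L → Set (suc (suc ℓ))
  Consistent T = Σ (Structure L) (_IsModelOf T)

  Complete : Theory L → Set (suc (suc ℓ))
  Complete T = (φ : Sentence L) → (T Entails φ) ⊎ (T Entails (¬′ φ))

module _ {ℓ} {L : Signature ℓ} (M : Structure L) where
  open Signature L
  open Structure M

  Elt : Set (suc ℓ)
  Elt = Σ Sort Dom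

  record Aut : Set (suc ℓ) where
    field
      bij : ∀ s → Dom s ↔ Dom s

    map : ∀ {s} → Dom s → Dom s
    map {s} = Inverse.to (bij s)

    field
      presFun : ∀ f xs → map (funI f xs) ≡ funI f (All.map map xs)
      presRel : ∀ r xs → relI r xs ⇔ relI r (All.map map xs)

    mapElt : Elt → Elt
    mapElt (s , x) = s , map x

  -- A small subset of M, presented as the image of a small family.  Only the
  -- image matters: equality and inclusion are those of the image, and
  -- relations between small sets depend only on the images as soon as they
  -- are invariant (take the identity automorphism).
  record SmallSet : Set (suc ℓ) where
    constructor small
    field
      Index : Set ℓ
      elt   : Index → Elt

  TernaryRelation : ∀ p → Set (suc ℓ ⊔ suc p)
  TernaryRelation p = SmallSet → SmallSet → SmallSet → Set p

module _ {ℓ} {L : Signature ℓ} {M : Structure L} where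
  open Signature L
  open Structure M
  open Aut
  open SmallSet

  ⟦_⟧ : SmallSet M → Pred (Elt M) (suc ℓ)
  ⟦ A ⟧ x = ∃[ i ] elt A i ≡ x

  infix 4 _⊑_
  _⊑_ : SmallSet M → SmallSet M → Set (suc ℓ)
  A ⊑ B = ⟦ A ⟧ ⊆ ⟦ B ⟧

  infixl 6 _∪_
  _∪_ : SmallSet M → SmallSet M → SmallSet M
  A ∪ B = small (Index A ⊎ Index B) [ elt A , elt B ]′

  ｛_｝ : Elt M → SmallSet M
  ｛ x ｝ = small ⊤ (λ _ → x)

  image : Aut M → SmallSet M → SmallSet M
  image σ A = small (Index A) (mapElt σ ∘ elt A)

  _Maps_Onto_ : Aut M → SmallSet M → SmallSet M → Set (suc ℓ)
  σ Maps A Onto A′ = ⟦ image σ A ⟧ ≐ ⟦ A′ ⟧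

  _Fixes_ : Aut M → SmallSet M → Set (suc ℓ)
  σ Fixes B = ∀ x → x ∈ ⟦ B ⟧ → mapElt σ x ≡ x

  infix 4 _≡[_]_
  _≡[_]_ : SmallSet M → SmallSet M → SmallSet M → Set (suc ℓ)
  A ≡[ B ] A′ = ∃[ σ ] σ Fixes B × σ Maps A Onto A′

  infix 4 _≡₃_
  _≡₃_ : (_ _ : SmallSet M × SmallSet M × SmallSet M) → Set (suc ℓ)
  (A , B , C) ≡₃ (A′ , B′ , C′) =
    ∃[ σ ] σ Maps A Onto A′ × σ Maps B Onto B′ × σ Maps C Onto C′

  -- Formulas with parameters in B and one free variable of sort s: the
  -- indices of B are used as names for the parameters.
  FormulaOver : SmallSet M → Sort → Set ℓ
  FormulaOver B s = Formula L (_▸_ L (ctx (Index B) (proj₁ ∘ elt B)) s)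

  Holds : (B : SmallSet M) {s : Sort} → Dom s → FormulaOver B s → Set (suc ℓ)
  Holds B x φ = Sat M (extend M (proj₂ ∘ elt B) x) φ

  acl : SmallSet M → Pred (Elt M) (suc ℓ)
  acl B (s , a) =
    Σ (FormulaOver B s) λ φ → Holds B a φ ×
      Σ (List (Dom s)) λ xs → ∀ x → Holds B x φ → x ∈ₗ xs

module _ {ℓ} {L : Signature ℓ} (M : Structure L) where
  open Signature L
  open Structure M

  Saturated : Set (suc ℓ)
  Saturated =
    (B : SmallSet M) (s : Sort) (π : Pred (FormulaOver B s) ℓ) →
    (∀ Δ → All π Δ → ∃[ x ] All (Holds B x) Δ) →
    ∃[ x ] (∀ φ → φ ∈ π → Holds B x φ)

  -- Contexts are small, so ρ and ρ′ are small tuples; the hypothesis says that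
  -- they have the same type.
  StronglyHomogeneous : Set (suc ℓ)
  StronglyHomogeneous =
    (Γ : Ctx L) (ρ ρ′ : Env M Γ) →
    (∀ φ → Sat M ρ φ ⇔ Sat M ρ′ φ) →
    Σ (Aut M) λ σ → ∀ i → Aut.map σ (ρ i) ≡ ρ′ i

-- κ-saturation and strong κ-homogeneity, the standard properties of a
-- big (monster) model; a saturated model of cardinality κ has both.
record IsBigModelOf {ℓ} {L : Signature ℓ} (T : Theory L) (M : Structure L)
    : Set (suc ℓ) where
  field
    model       : M IsModelOf T
    saturated   : Saturated M
    homogeneous : StronglyHomogeneous M

-- The base comes second: R A C B reads "A is independent from B over C".
module _ {ℓ p} {L : Signature ℓ} {M : Structure L}
         (_⫝[_]_ : TernaryRelation M p) where

  Invariance : Set (suc ℓ ⊔ p)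
  Invariance = ∀ A B C A′ B′ C′ →
    A ⫝[ C ] B → (A′ , B′ , C′) ≡₃ (A , B , C) → A′ ⫝[ C′ ] B′

  Monotonicity : Set (suc ℓ ⊔ p)
  Monotonicity = ∀ A B C A′ B′ →
    A ⫝[ C ] B → A′ ⊑ A → B′ ⊑ B → A′ ⫝[ C ] B′

  BaseMonotonicity : Set (suc ℓ ⊔ p)
  BaseMonotonicity = ∀ A B C D →
    D ⊑ C → C ⊑ B → A ⫝[ D ] B → A ⫝[ C ] B

  Transitivity : Set (suc ℓ ⊔ p)
  Transitivity = ∀ A B C D →
    D ⊑ C → C ⊑ B → B ⫝[ C ] A → C ⫝[ D ] A → B ⫝[ D ] A

  Normality : Set (suc ℓ ⊔ p)
  Normality = ∀ A B C → A ⫝[ C ] B → (A ∪ C) ⫝[ C ] B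

  Extension : Set (suc ℓ ⊔ p)
  Extension = ∀ A B C B̂ → A ⫝[ C ] B → B ⊑ B̂ →
    ∃[ A′ ] (A′ ≡[ B ∪ C ] A) × (A′ ⫝[ C ] B̂)

  AntiReflexivity : Set (suc ℓ ⊔ p)
  AntiReflexivity = ∀ a B → ｛ a ｝ ⫝[ B ] ｛ a ｝ → a ∈ acl B

  Existence : Set (suc ℓ ⊔ p)
  Existence = ∀ A B C → ∃[ A′ ] (A′ ≡[ C ] A) × (A′ ⫝[ C ] B)

  _* : TernaryRelation M (suc ℓ ⊔ p)
  _* A C B = ∀ B̂ → B ⊑ B̂ → ∃[ A′ ] (A′ ≡[ B ∪ C ] A) × (A′ ⫝[ C ] B̂)

{-# OPTIONS --safe #-}
module Submission where

open import Defs
open import Level using (Level; _⊔_; suc; Lift; lift; lower)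
open import Axiom.ExcludedMiddle using (ExcludedMiddle)
open import Axiom.DoubleNegationElimination using (em⇒dne)
open import Data.Bool.Base using (Bool; T)
open import Data.Empty.Polymorphic using (⊥)
open import Data.List.Relation.Unary.All using (All)
import Data.List.Relation.Unary.All as All
open import Data.List.Relation.Unary.All.Properties using (map-cong; map-id; map-∘)
open import Data.Product using (Σ; ∃-syntax; _×_; _,_; proj₁; proj₂)
open import Data.Sum.Base using (inj₁; inj₂)
open import Function.Base using (_∘_; id)
open import Function.Bundles using (_⇔_; Inverse; mk⇔)
open import Function.Properties.Equivalence using (⇔-isEquivalence)
open import Function.Properties.Inverse using (↔-sym; ↔-trans)
open import Relation.Binary.PropositionalEquality
  using (_≡_; refl; sym; trans; cong; subst; module ≡-Reasoning)
open import Relation.Binary.Structures using (IsEquivalence)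
open import Relation.Nullary using (¬_; Dec; yes; no; contradiction)
open import Relation.Nullary.Decidable using (isYes; map′; toWitness; fromWitness)

-- Most properties pass to `R *` by applying its definition to a well-chosen enlargement,
-- transporting the resulting conjugate by automorphisms, and invoking the property of `R`.
-- Extension is the real point. The conjugate of `A` supplied by `R *` varies with the enlargement,
-- whereas one type over `B̂ ∪ C` must now serve all enlargements of `B̂` at once. Strong
-- homogeneity makes the type of a tuple determine its conjugacy class (`typeOver-≡⇒≡[]`), and there
-- are only few types. If each of them failed, one bad enlargement per type could be collected into
-- a single small set (`small-cover`), which refutes the hypothesis. Existence then follows from
-- extension, because existence for `R` already makes every `A` independent from `C` over `C` in the
-- sense of `R *`.

module Automorphisms {ℓ} {L : Signature ℓ} {M : Structure L} where
  open Signature L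
  open Structure M
  open Aut

  infixr 9 _∙_
  infix 10 _⁻¹

  _∙_ : Aut M → Aut M → Aut M
  (σ ∙ τ) .bij s = ↔-trans (bij τ s) (bij σ s)
  (σ ∙ τ) .presFun f xs = begin
    map σ (map τ (funI f xs))                      ≡⟨ cong (map σ) (presFun τ f xs) ⟩
    map σ (funI f (All.map (map τ) xs))            ≡⟨ presFun σ f _ ⟩
    funI f (All.map (map σ) (All.map (map τ) xs))  ≡⟨ cong (funI f) (map-∘ xs) ⟩
    funI f (All.map (map σ ∘ map τ) xs)            ∎
    where open ≡-Reasoning
  (σ ∙ τ) .presRel r xs = subst (λ ys → relI r xs ⇔ relI r ys) (map-∘ xs)
    (IsEquivalence.trans ⇔-isEquivalence (presRel τ r xs) (presRel σ r _))

  private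
    map-map⁻¹ : ∀ (σ : Aut M) {ss} (xs : All Dom ss) →
      All.map (map σ) (All.map (λ {s} → Inverse.from (bij σ s)) xs) ≡ xs
    map-map⁻¹ σ xs = trans (map-∘ xs)
      (trans (map-cong xs (λ {s} → Inverse.strictlyInverseˡ (bij σ s))) (map-id xs))

  _⁻¹ : Aut M → Aut M
  (σ ⁻¹) .bij s = ↔-sym (bij σ s)
  (σ ⁻¹) .presFun f xs = begin
    from (funI f xs)                          ≡⟨ cong (from ∘ funI f) (map-map⁻¹ σ xs) ⟨
    from (funI f (All.map (map σ) xs⁻))       ≡⟨ cong from (presFun σ f xs⁻) ⟨
    from (map σ (funI f xs⁻))                 ≡⟨ Inverse.strictlyInverseʳ (bij σ _) _ ⟩
    funI f xs⁻                                ∎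
    where
    open ≡-Reasoning
    from : ∀ {s} → Dom s → Dom s
    from {s} = Inverse.from (bij σ s)
    xs⁻ = All.map from xs
  (σ ⁻¹) .presRel r xs = IsEquivalence.sym ⇔-isEquivalence
    (subst (λ ys → relI r xs⁻ ⇔ relI r ys) (map-map⁻¹ σ xs) (presRel σ r xs⁻))
    where xs⁻ = All.map (λ {s} → Inverse.from (bij σ s)) xs

  inverseˡ : ∀ (σ : Aut M) x → mapElt (σ ⁻¹) (mapElt σ x) ≡ x
  inverseˡ σ (s , x) = cong (s ,_) (Inverse.strictlyInverseʳ (bij σ s) x)

-- The action of automorphisms on small sets, and conjugacy.

module SmallSets {ℓ} {L : Signature ℓ} {M : Structure L} where
  open Signature L
  open Structure M
  open Aut
  open SmallSet
  open Automorphisms {M = M}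

  private variable
    A B C : SmallSet M

  ∪-inˡ : ∀ (A B : SmallSet M) → A ⊑ A ∪ B
  ∪-inˡ A B (i , eq) = inj₁ i , eq

  ∪-inʳ : ∀ (A B : SmallSet M) → B ⊑ A ∪ B
  ∪-inʳ A B (i , eq) = inj₂ i , eq

  ∪-lub : A ⊑ C → B ⊑ C → A ∪ B ⊑ C
  ∪-lub A⊑C B⊑C (inj₁ i , eq) = A⊑C (i , eq)
  ∪-lub A⊑C B⊑C (inj₂ i , eq) = B⊑C (i , eq)

  ∪-monoˡ : ∀ (C : SmallSet M) → A ⊑ B → A ∪ C ⊑ B ∪ C
  ∪-monoˡ {A} {B} C A⊑B = ∪-lub {A} {B ∪ C} {C} (∪-inˡ B C ∘ A⊑B) (∪-inʳ B C)

  image-∈ : ∀ (σ : Aut M) (A : SmallSet M) {x} → ⟦ A ⟧ x → ⟦ image σ A ⟧ (mapElt σ x)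
  image-∈ σ A (i , refl) = i , refl

  image-mono : ∀ (σ : Aut M) A B → A ⊑ B → image σ A ⊑ image σ B
  image-mono σ A B A⊑B (i , refl) = image-∈ σ B (A⊑B (i , refl))

  maps-image : ∀ (σ : Aut M) A → σ Maps A Onto image σ A
  maps-image σ A = id , id

  maps-sym : ∀ (σ : Aut M) A B → σ Maps A Onto B → (σ ⁻¹) Maps B Onto A
  maps-sym σ A B (to , from) = to⁻ , from⁻
    where
    to⁻ : image (σ ⁻¹) B ⊑ A
    to⁻ (j , refl) with from (j , refl)
    ... | i , eq = i , trans (sym (inverseˡ σ _)) (cong (mapElt (σ ⁻¹)) eq)
    from⁻ : A ⊑ image (σ ⁻¹) B
    from⁻ (i , refl) with to (i , refl)
    ... | j , eq = j , trans (cong (mapElt (σ ⁻¹)) eq) (inverseˡ σ _)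

  maps-image⁻¹ : ∀ (σ : Aut M) A → σ Maps image (σ ⁻¹) A Onto A
  maps-image⁻¹ σ A = maps-sym (σ ⁻¹) A (image (σ ⁻¹) A) (maps-image (σ ⁻¹) A)

  maps-trans : ∀ (σ τ : Aut M) A B C → τ Maps A Onto B → σ Maps B Onto C → (σ ∙ τ) Maps A Onto C
  maps-trans σ τ A B C (τto , τfrom) (σto , σfrom) = to , from
    where
    to : image (σ ∙ τ) A ⊑ C
    to (i , refl) = σto (image-∈ σ B (τto (i , refl)))
    from : C ⊑ image (σ ∙ τ) A
    from c with σfrom c
    ... | j , refl with τfrom (j , refl)
    ... | i , eq = i , cong (mapElt σ) eq

  maps-∪ : ∀ (σ : Aut M) A A′ B B′ → σ Maps A Onto A′ → σ Maps B Onto B′ →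
    σ Maps A ∪ B Onto (A′ ∪ B′)
  maps-∪ σ A A′ B B′ (Ato , Afrom) (Bto , Bfrom) = to , from
    where
    to : image σ (A ∪ B) ⊑ A′ ∪ B′
    to (inj₁ i , eq) = ∪-inˡ A′ B′ (Ato (i , eq))
    to (inj₂ i , eq) = ∪-inʳ A′ B′ (Bto (i , eq))
    from : A′ ∪ B′ ⊑ image σ (A ∪ B)
    from (inj₁ i , eq) with Afrom (i , eq)
    ... | j , eq′ = inj₁ j , eq′
    from (inj₂ i , eq) with Bfrom (i , eq)
    ... | j , eq′ = inj₂ j , eq′

  maps-mono : ∀ (σ : Aut M) A A′ B B′ → σ Maps A Onto A′ → σ Maps B Onto B′ → A ⊑ B → A′ ⊑ B′
  maps-mono σ A A′ B B′ (_ , Afrom) (Bto , _) A⊑B = Bto ∘ image-mono σ A B A⊑B ∘ Afrom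

  fixes⇒maps : ∀ (σ : Aut M) A → σ Fixes A → σ Maps A Onto A
  fixes⇒maps σ A fix = to , from
    where
    to : image σ A ⊑ A
    to (i , refl) = i , sym (fix _ (i , refl))
    from : A ⊑ image σ A
    from (i , refl) = i , fix _ (i , refl)

  fixes-⊑ : ∀ (σ : Aut M) A B → A ⊑ B → σ Fixes B → σ Fixes A
  fixes-⊑ σ A B A⊑B fix x x∈A = fix x (A⊑B x∈A)

  fixes-⁻¹ : ∀ (σ : Aut M) A → σ Fixes A → (σ ⁻¹) Fixes A
  fixes-⁻¹ σ A fix x x∈A =
    trans (cong (mapElt (σ ⁻¹)) (sym (fix x x∈A))) (inverseˡ σ x)

  fixes-∙ : ∀ (σ τ : Aut M) A → σ Fixes A → τ Fixes A → (σ ∙ τ) Fixes A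
  fixes-∙ σ τ A fixσ fixτ x x∈A = trans (cong (mapElt σ) (fixτ x x∈A)) (fixσ x x∈A)

  fixes-conj : ∀ (σ τ : Aut M) A B → σ Maps A Onto B → τ Fixes B → (σ ⁻¹ ∙ τ ∙ σ) Fixes A
  fixes-conj σ τ A B (to , _) fix x x∈A =
    trans (cong (mapElt (σ ⁻¹)) (fix _ (to (image-∈ σ A x∈A)))) (inverseˡ σ x)

  ≡[]-trans : ∀ (A B C D : SmallSet M) → A ≡[ D ] B → B ≡[ D ] C → A ≡[ D ] C
  ≡[]-trans A B C D (τ , fixτ , τA≐B) (σ , fixσ , σB≐C) =
    σ ∙ τ , fixes-∙ σ τ D fixσ fixτ , maps-trans σ τ A B C τA≐B σB≐C

  ≡[]-weaken : ∀ A B C D → C ⊑ D → A ≡[ D ] B → A ≡[ C ] B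
  ≡[]-weaken A B C D C⊑D (σ , fix , maps) = σ , fixes-⊑ σ C D C⊑D fix , maps

  ≡[]-image⁻¹ : ∀ (σ : Aut M) A D → σ Fixes D → image (σ ⁻¹) A ≡[ D ] A
  ≡[]-image⁻¹ σ A D fix = σ , fix , maps-image⁻¹ σ A

  -- ExcludedMiddle decides types rather than propositions, so it also acts as
  -- a choice principle: it selects one x for each code that occurs.
  small-cover : ExcludedMiddle (suc ℓ) → {Q : Set ℓ} {X : Set (suc ℓ)}
    (code : X → Q) (F : X → SmallSet M) →
    ∃[ U ] (∀ x → ∃[ y ] code y ≡ code x × F y ⊑ U)
  small-cover em {Q} {X} code F = U , cover
    where
    Coded : Q → Set (suc ℓ)
    Coded c = Σ X λ x → code x ≡ c

    chosen : ∀ {c} → Dec (Coded c) → SmallSet M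
    chosen (yes (x , _)) = F x
    chosen (no _)        = small ⊥ λ ()

    U : SmallSet M
    U = small (Σ Q λ c → Index (chosen (em {Coded c})))
              (λ (c , i) → elt (chosen (em {Coded c})) i)

    chosen-⊑ : ∀ c → chosen (em {Coded c}) ⊑ U
    chosen-⊑ c (i , eq) = (c , i) , eq

    -- The decision is an argument so that matching on it also reduces `chosen`; the `y` found is
    -- the representative of the code of `x`, possibly different from `x`.
    pick : ∀ x (d : Dec (Coded (code x))) → chosen d ⊑ U →
      ∃[ y ] code y ≡ code x × F y ⊑ U
    pick x (yes (y , eq)) sub = y , eq , sub
    pick x (no ¬c)        _   = contradiction (x , refl) ¬c

    cover : ∀ x → ∃[ y ] code y ≡ code x × F y ⊑ U
    cover x = pick x em (chosen-⊑ (code x))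

-- Types over small sets and the conjugacy they determine.

module Types {ℓ} {L : Signature ℓ} {M : Structure L}
             (em : ExcludedMiddle (suc ℓ)) (homogeneous : StronglyHomogeneous M) where
  open Signature L
  open Structure M
  open Aut
  open SmallSet

  module _ (A P : SmallSet M) where

    Names : Ctx L
    Names = ctx (Index (A ∪ P)) (proj₁ ∘ elt (A ∪ P))

    -- Only the names of `A` are moved, so formulas in `Names` describe the tuple enumerating
    -- `image σ A` over the fixed parameters `P`.
    imageEnv : Aut M → Env M Names
    imageEnv σ (inj₁ i) = map σ (proj₂ (elt A i))
    imageEnv σ (inj₂ j) = proj₂ (elt P j)

    -- Types valued in Bool, unlike sets of true formulas, form a small type.
    typeOver : Aut M → Formula L Names → Bool
    typeOver σ φ = isYes (em {Sat M (imageEnv σ) φ})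

    typeOver-transfer : ∀ σ τ → typeOver σ ≡ typeOver τ →
      ∀ φ → Sat M (imageEnv σ) φ → Sat M (imageEnv τ) φ
    typeOver-transfer σ τ eq φ s =
      toWitness {a? = em} (subst (λ f → T (f φ)) eq (fromWitness {a? = em} s))

    -- The two environments satisfy the same formulas, so strong homogeneity carries one to the
    -- other. They agree on the names of `P`, hence the automorphism obtained fixes `P`.
    typeOver-≡⇒≡[] : ∀ σ τ → typeOver σ ≡ typeOver τ → image σ A ≡[ P ] image τ A
    typeOver-≡⇒≡[] σ τ eq
      with homogeneous Names (imageEnv σ) (imageEnv τ)
             (λ φ → mk⇔ (typeOver-transfer σ τ eq φ) (typeOver-transfer τ σ (sym eq) φ))
    ... | υ , υ-spec = υ , fixes , to , from
      where
      υ-image : ∀ i → mapElt υ (mapElt σ (elt A i)) ≡ mapElt τ (elt A i)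
      υ-image i = cong (_ ,_) (υ-spec (inj₁ i))
      fixes : υ Fixes P
      fixes _ (j , refl) = cong (_ ,_) (υ-spec (inj₂ j))
      to : image υ (image σ A) ⊑ image τ A
      to (i , refl) = i , sym (υ-image i)
      from : image τ A ⊑ image υ (image σ A)
      from (i , refl) = i , υ-image i

-- Properties inherited by the derived relation.

module Star {ℓ p} {L : Signature ℓ} {M : Structure L} (R : TernaryRelation M p)
            (inv : Invariance R) (mono : Monotonicity R) where
  open Automorphisms {M = M}
  open SmallSets {M = M}

  -- Push `B̂` forward along `σ`, find the conjugate there and pull it back; conjugating the witness
  -- `τ` by `σ` and then using invariance of `R` gives the claim.
  *-invariance : Invariance (R *)
  *-invariance A B C A′ B′ C′ A*B (σ , σA , σB , σC) B̂ B′⊑B̂ =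
    let A₁ , (τ , fix , τA₁) , A₁RσB̂ = A*B (image σ B̂)
          (image-mono σ B′ B̂ B′⊑B̂ ∘ proj₂ σB)
        A″ = image (σ ⁻¹) A₁
    in A″
     , ( σ ⁻¹ ∙ τ ∙ σ
       , fixes-conj σ τ (B′ ∪ C′) (B ∪ C) (maps-∪ σ B′ B C′ C σB σC) fix
       , maps-trans (σ ⁻¹) (τ ∙ σ) A″ A A′
           (maps-trans τ σ A″ A₁ A (maps-image⁻¹ σ A₁) τA₁) (maps-sym σ A′ A σA) )
     , inv A₁ (image σ B̂) C A″ B̂ C′ A₁RσB̂ (σ , maps-image⁻¹ σ A₁ , maps-image σ B̂ , σC)

  *-monotonicity : Monotonicity (R *)
  *-monotonicity A B C A′ B′ A*B A′⊑A B′⊑B B̂ B′⊑B̂ =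
    -- `B̂` contains `B′` but perhaps not `B`, so `B` is added. The part of `A₁` that `τ` sends onto
    -- `A′` is the required conjugate.
    let A₁ , (τ , fix , τA₁) , A₁RB̂B = A*B (B̂ ∪ B) (∪-inʳ B̂ B)
    in image (τ ⁻¹) A′
     , ≡[]-image⁻¹ τ A′ (B′ ∪ C)
         (fixes-⊑ τ (B′ ∪ C) (B ∪ C) (∪-monoˡ {B′} {B} C B′⊑B) fix)
     , mono A₁ (B̂ ∪ B) C (image (τ ⁻¹) A′) B̂ A₁RB̂B
         (maps-mono (τ ⁻¹) A′ (image (τ ⁻¹) A′) A A₁
           (maps-image (τ ⁻¹) A′) (maps-sym τ A₁ A τA₁) A′⊑A)
         (∪-inˡ B̂ B)

  *-baseMonotonicity : BaseMonotonicity R → BaseMonotonicity (R *)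
  *-baseMonotonicity bmono A B C D D⊑C C⊑B A*B B̂ B⊑B̂ =
    let A₁ , A₁≡A , A₁RB̂ = A*B B̂ B⊑B̂
    in A₁
     -- As `C ⊑ B`, the larger base `C` adds nothing to the parameters that must be fixed.
     , ≡[]-weaken A₁ A (B ∪ C) (B ∪ D)
         (∪-inˡ B D ∘ ∪-lub {B} {B} {C} id C⊑B) A₁≡A
     , bmono A₁ B̂ C D D⊑C (B⊑B̂ ∘ C⊑B) A₁RB̂

  -- The two hypotheses are used in succession: `C` is moved to `C₁`, independent from `Â` over `D`,
  -- with `B` carried along to `B₁`; then `B₁` is moved over `A ∪ C₁` to `B₂`, independent from `Â`
  -- over `C₁`. The second move fixes `C₁`, so `C₁ ⊑ B₂` and transitivity of `R` applies.
  *-transitivity : Transitivity R → Transitivity (R *)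
  *-transitivity trns A B C D D⊑C C⊑B B*A C*A Â A⊑Â =
    let C₁ , (σ , σfix , σC₁) , C₁RÂ = C*A Â A⊑Â
        B₁ = image (σ ⁻¹) B
        σB₁ = maps-image⁻¹ σ B
        σA = fixes⇒maps σ A (fixes-⊑ σ A (A ∪ D) (∪-inˡ A D) σfix)
        σD = fixes⇒maps σ D (fixes-⊑ σ D (A ∪ D) (∪-inʳ A D) σfix)
        σ⁻¹C = maps-sym σ C₁ C σC₁
        B₁*A = *-invariance B A C B₁ A C₁ B*A (σ , σB₁ , σA , σC₁)
        B₂ , (τ , τfix , τB₂) , B₂RÂ = B₁*A Â A⊑Â
        τC₁ = fixes⇒maps τ C₁ (fixes-⊑ τ C₁ (A ∪ C₁) (∪-inʳ A C₁) τfix)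
        D⊑C₁ = maps-mono (σ ⁻¹) D D C C₁ (maps-sym σ D D σD) σ⁻¹C D⊑C
        C₁⊑B₁ = maps-mono (σ ⁻¹) C C₁ B B₁ σ⁻¹C (maps-image (σ ⁻¹) B) C⊑B
        C₁⊑B₂ = maps-mono (τ ⁻¹) C₁ C₁ B₁ B₂
                  (maps-sym τ C₁ C₁ τC₁) (maps-sym τ B₂ B₁ τB₂) C₁⊑B₁
        AD⊑AC₁ = ∪-lub {A} {A ∪ C₁} {D} (∪-inˡ A C₁) (∪-inʳ A C₁ ∘ D⊑C₁)
    in B₂
     , ≡[]-trans B₂ B₁ B (A ∪ D)
         (≡[]-weaken B₂ B₁ (A ∪ D) (A ∪ C₁) AD⊑AC₁ (τ , τfix , τB₂))
         (σ , σfix , σB₁)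
     , trns Â B₂ C₁ D D⊑C₁ C₁⊑B₂ B₂RÂ C₁RÂ

  *-normality : Normality R → Normality (R *)
  *-normality norm A B C A*B B̂ B⊑B̂ =
    let A₁ , (σ , fix , σA₁) , A₁RB̂ = A*B B̂ B⊑B̂
        σC = fixes⇒maps σ C (fixes-⊑ σ C (B ∪ C) (∪-inʳ B C) fix)
    in A₁ ∪ C , (σ , fix , maps-∪ σ A₁ A C C σA₁ σC) , norm A₁ B̂ C A₁RB̂

  *-antiReflexivity : AntiReflexivity R → AntiReflexivity (R *)
  *-antiReflexivity anti a B a*a =
    -- No proper enlargement is needed: `σ` fixes `a`, so the conjugate `A₁` still contains `a`.
    let A₁ , (σ , fix , σA₁) , A₁Ra = a*a ｛ a ｝ id
        σa = fixes⇒maps σ ｛ a ｝ (fixes-⊑ σ ｛ a ｝ (｛ a ｝ ∪ B) (∪-inˡ ｛ a ｝ B) fix)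
        a⊑A₁ = maps-mono (σ ⁻¹) ｛ a ｝ ｛ a ｝ ｛ a ｝ A₁
                 (maps-sym σ ｛ a ｝ ｛ a ｝ σa) (maps-sym σ A₁ ｛ a ｝ σA₁) id
    in anti a B (mono A₁ ｛ a ｝ B ｛ a ｝ ｛ a ｝ A₁Ra a⊑A₁ id)

  -- Extension and existence, by counting types.

  module _ (em : ExcludedMiddle (suc ℓ ⊔ p)) (homogeneous : StronglyHomogeneous M) where

    private
      em₀ : ExcludedMiddle (suc ℓ)
      em₀ {P} = map′ lower lift (em {Lift p P})

    open Types em₀ homogeneous

    -- If extension fails, each σ A with σ fixing BC has a set B̃ ⊇ B̂ from which no
    -- conjugate of σ A over B̂C is independent over C.  Choose one B̃ for each type over B̂C
    -- realised by such a σ A; their union U is small as there are few types.  But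
    -- A *-independent from B gives a conjugate of A over BC independent from B̂U,
    -- in particular from the B̃ chosen for its own type.
    *-extension : Extension (R *)
    *-extension A B C B̂ A*B B⊑B̂ = em⇒dne em λ none → absurd λ (σ , σfix) →
      em⇒dne em λ noWitness →
        none (image σ A ,
          (σ ⁻¹ , fixes-⁻¹ σ (B ∪ C) σfix , maps-sym σ A (image σ A) (maps-image σ A)) ,
          λ B̃ B̂⊑B̃ → em⇒dne em λ dependent → noWitness (B̃ , B̂⊑B̃ , dependent))
      where
      Fixing : Set (suc ℓ)
      Fixing = Σ (Aut M) (_Fixes (B ∪ C))

      IndependentConjugate : SmallSet M → SmallSet M → Set (suc ℓ ⊔ p)
      IndependentConjugate A₁ B̃ = ∃[ A₂ ] (A₂ ≡[ B̂ ∪ C ] A₁) × R A₂ C B̃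

      absurd : ¬ ((x : Fixing) →
        ∃[ B̃ ] B̂ ⊑ B̃ × ¬ IndependentConjugate (image (proj₁ x) A) B̃)
      absurd counterexample
        with small-cover em₀ (typeOver A (B̂ ∪ C) ∘ proj₁) (proj₁ ∘ counterexample)
      ... | U , cover
        with A*B (B̂ ∪ U) (∪-inˡ B̂ U ∘ B⊑B̂)
      ... | A₁ , (σ , σfix , σA₁) , A₁RU
        with cover (σ ⁻¹ , fixes-⁻¹ σ (B ∪ C) σfix)
      -- The set inside `U` was chosen for `τ`, which may differ from `σ ⁻¹`. Having the same type,
      -- `σ⁻¹A` is a conjugate of `image τ A` over `B̂ ∪ C`, which contradicts that choice.
      ... | (τ , τfix) , sameType , B̃⊑U =
        proj₂ (proj₂ (counterexample (τ , τfix)))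
          ( σ⁻¹A
          , typeOver-≡⇒≡[] A (B̂ ∪ C) (σ ⁻¹) τ (sym sameType)
          , mono A₁ (B̂ ∪ U) C σ⁻¹A B̃ A₁RU
              (proj₁ (maps-sym σ A₁ A σA₁))
              (∪-inʳ B̂ U ∘ B̃⊑U) )
        where
        σ⁻¹A = image (σ ⁻¹) A
        B̃ = proj₁ (counterexample (τ , τfix))

    *-existence : Existence R → Existence (R *)
    *-existence exist A B C =
      let A₁ , A₁≡A , A₁*CB = *-extension A C C (C ∪ B) A*C (∪-inˡ C B)
      in A₁
       , ≡[]-weaken A₁ A C (C ∪ C) (∪-inˡ C C) A₁≡A
       , *-monotonicity A₁ (C ∪ B) C A₁ B A₁*CB id (∪-inʳ C B)
      where
      -- With `C` on the right side as well, the conjugacy demanded is over `C` alone, so existence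
      -- for `R` applies to each enlargement.
      A*C : (R *) A C C
      A*C B̂ _ =
        let A₁ , A₁≡A , A₁RB̂ = exist A B̂ C
        in A₁ , ≡[]-weaken A₁ A (C ∪ C) C (∪-lub {C} {C} {C} id id) A₁≡A , A₁RB̂

lemma1p17 : (ℓ p : Level) → ExcludedMiddle (suc ℓ ⊔ p) →
    (L : Signature ℓ) (T : Theory L) → Consistent T → Complete T →
    (M : Structure L) → IsBigModelOf T M →
    (R : TernaryRelation M p) → Invariance R → Monotonicity R →
    (Invariance (R *) × Monotonicity (R *) × Extension (R *))
    × (BaseMonotonicity R → BaseMonotonicity (R *))
    × (Transitivity R → Transitivity (R *))
    × (Normality R → Normality (R *))
    × (AntiReflexivity R → AntiReflexivity (R *))
    × (Existence R → Existence (R *))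
lemma1p17 ℓ p em L T _ _ M big R inv mono =
    (*-invariance , *-monotonicity , *-extension em homogeneous)
  , *-baseMonotonicity , *-transitivity , *-normality , *-antiReflexivity
  , *-existence em homogeneous
  where
  open Star R inv mono
  open IsBigModelOf big using (homogeneous)
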